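{- For all $r,t\in\mathbb{N}$, every graph $G$ that does not contain the complete graph $K_t$ as a minor satisfies $\operatorname{cw}_r(G)\leq \binom{t-1}{2}(8r+1)$.
   Context: All graphs are finite, simple and undirected; $\mathbb{N}=\{1,2,\dots\}$. Cop-width game with radius $r$ and width $k$ on $G$: initially the cops occupy a set $C_0\subseteq V(G)$ with $|C_0|\le k$ and the robber chooses a vertex $x_0$. In each round $i\ge1$, the cops announce a new set $C_i\subseteq V(G)$ with $|C_i|\le k$; the robber, knowing $C_i$, moves from $x_{i-1}$ to a vertex $x_i$ along a path in $G$ of length at most $r$ containing no vertex of $C_{i-1}\cap C_i$. The robber is caught if $x_i\in C_i$. The radius-$r$ cop-width $\operatorname{cw}_r(G)$ is the least $k\in\mathbb{N}$ such that the cops can guarantee capture in finitely many rounds.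
   Formalization: The theorem is stated for t ≥ 3: for t ≤ 2 the bound is 0, while the cop-width is at least 1 by definition (for example, the one-vertex graph has no K_2 minor and has cop-width 1), so the claim fails there. -}

module Defs where

open import Data.Nat using (ℕ; zero; suc; _≤_)
open import Data.Fin using (Fin)
open import Data.Fin.Subset using (Subset; _∈_; _∉_; _∩_; ∣_∣)
open import Data.Maybe using (Maybe; just)
open import Data.Product using (Σ; ∃; ∃₂; _×_)
open import Data.Sum using (_⊎_)
open import Relation.Binary.PropositionalEquality using (_≡_; _≢_)
open import Relation.Nullary using (¬_)

record Graph : Set₁ where
  field
    n     : ℕ
    Adj   : Fin n → Fin n → Set
    sym   : ∀ {u v} → Adj u v → Adj v u
    irref : ∀ {u} → ¬ Adj u u

module _ (G : Graph) where
  open Graph G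

  data WalkIn (P : Fin n → Set) : Fin n → Fin n → Set where
    here : ∀ {x} → P x → WalkIn P x x
    step : ∀ {x y z} → P x → Adj x y → WalkIn P y z → WalkIn P x z

  -- K_t minor model: disjoint (built in) nonempty connected branch sets,
  -- pairwise joined by an edge.
  record CliqueMinor (t : ℕ) : Set where
    field
      branch    : Fin n → Maybe (Fin t)
      nonempty  : ∀ i → ∃ λ v → branch v ≡ just i
      connected : ∀ i u v → branch u ≡ just i → branch v ≡ just i →
                  WalkIn (λ w → branch w ≡ just i) u v
      adjacent  : ∀ i j → i ≢ j → ∃₂ λ u v →
                  branch u ≡ just i × branch v ≡ just j × Adj u v

  HasCliqueMinor : ℕ → Set
  HasCliqueMinor t = CliqueMinor t

  data Reach (S : Subset n) : ℕ → Fin n → Fin n → Set where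
    here : ∀ {m x} → x ∉ S → Reach S m x x
    step : ∀ {m x y z} → x ∉ S → Adj x y → Reach S m y z → Reach S (suc m) x z

  -- CopsWinFrom r k C x : in the position where the cops currently occupy C
  -- and the robber (not caught) is at x, the cops can force capture in
  -- finitely many rounds (inductive = well-founded attractor).
  data CopsWinFrom (r k : ℕ) : Subset n → Fin n → Set where
    win : ∀ {C x} (C′ : Subset n) → ∣ C′ ∣ ≤ k →
          (∀ x′ → Reach (C ∩ C′) r x x′ → x′ ∈ C′ ⊎ CopsWinFrom r k C′ x′) →
          CopsWinFrom r k C x

  CopsWin : ℕ → ℕ → Set
  CopsWin r k = Σ (Subset n) λ C₀ → ∣ C₀ ∣ ≤ k ×
                (∀ x₀ → x₀ ∈ C₀ ⊎ CopsWinFrom r k C₀ x₀)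

  -- cw_r(G) ≤ B, where cw_r(G) is the least k ∈ {1,2,…} with CopsWin r k
  CopWidthAtMost : ℕ → ℕ → Set
  CopWidthAtMost r B = ∃ λ k → 1 ≤ k × k ≤ B × CopsWin r k

{-# OPTIONS --safe #-}
module Submission where

open import Defs
open import Data.Empty using (⊥-elim)
open import Data.Fin using (Fin; zero; suc; combine; inject≤; _≟_)
open import Data.Fin.Properties using (any?; combine-injective; inject≤-injective)
open import Data.Fin.Subset using (Subset; _∈_; _∉_; _⊆_; _⊂_; _⊃_; _∩_; _∪_; ∁; ⁅_⁆; ∣_∣; ⊤; inside; outside) renaming (⊥ to ∅)
open import Data.Fin.Subset.Induction using (⊂-wellFounded; ⊃-wellFounded)
open import Data.Fin.Subset.Properties using (_∈?_; ∉⊥; ∈⊤; ∣⊥∣≡0; ∣⁅x⁆∣≡1; x∈⁅x⁆; x∈⁅y⁆⇒x≡y; x∈p∪q⁺; x∈p∪q⁻; x∈p∩q⁺; x∈p∩q⁻; p⊆p∪q; q⊆p∪q; x∈∁p⇒x∉p; x∉p⇒x∈∁p)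
open import Data.List using (List; []; _∷_; length; lookup; filter)
open import Data.List.Membership.Propositional using (find; lose)
open import Data.List.Membership.Propositional.Properties using (∈-filter⁺; ∈-lookup)
open import Data.List.Relation.Unary.All as All using (All; []; _∷_)
open import Data.List.Relation.Unary.All.Properties using (all-filter) renaming (filter⁺ to All-filter⁺)
open import Data.List.Relation.Unary.AllPairs using (AllPairs; []; _∷_)
open import Data.List.Relation.Unary.AllPairs.Properties using () renaming (filter⁺ to AllPairs-filter⁺)
open import Data.List.Relation.Unary.Any using (Any; here; there)
open import Data.Maybe using (Maybe; just; nothing)
open import Data.Nat using (ℕ; zero; suc; _≤_; _*_; _+_; _∸_; z≤n; s≤s)
open import Data.Nat.Combinatorics using (_C_; nC1≡n; nCk+nC[k+1]≡[n+1]C[k+1])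
open import Data.Nat.Properties using (≤-refl; ≤-trans; ≤-reflexive; ≤-pred; m≤m+n; m≤n+m; +-assoc; +-suc; +-mono-≤; +-monoˡ-≤; +-monoʳ-≤; +-cancelʳ-≤; *-monoˡ-≤; *-cancelˡ-≤; *-assoc; *-distribˡ-+; ≰⇒>; module ≤-Reasoning)
open import Data.Nat.Tactic.RingSolver using (solve-∀)
open import Data.Product using (∃; ∃₂; _×_; _,_; proj₁; proj₂)
open import Data.Sum using (_⊎_; inj₁; inj₂; [_,_]′)
open import Data.Vec using ([]; _∷_)
open import Function using (_∘_)
open import Induction.WellFounded using (Acc; acc)
open import Relation.Binary.Definitions using (Symmetric)
open import Relation.Binary.PropositionalEquality using (_≡_; _≢_; refl; sym; trans; cong; cong₂; subst)
open import Relation.Nullary using (¬_; Dec; yes; no)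
open import Relation.Nullary.Decidable using (_×-dec_; _⊎-dec_; ¬?; map′)

-- The robber is kept in a connected territory X whose boundary lies in "bags":
-- connected, pairwise disjoint and adjacent sets, all adjacent to X. Together
-- with X they form a clique minor, so there are at most t - 2 of them. In each
-- round the cops add a bag N, the union of geodesics of X from the robber's
-- vertex to the existing bags, and pass to the component of X - N containing
-- the robber; bags no longer adjacent to it are discarded. Only bag vertices
-- within distance 2r - 1 of the robber need cops, and a geodesic has at most
-- 4r - 1 of these, so (t - 1)((t - 2)(4r - 1) + 1) cops suffice.
--
-- Adjacency is not assumed decidable. The cops therefore play on the subgraph of
-- edges seen so far; a robber move outside it reveals a new edge, after which
-- they start again, and this happens only finitely often.

-- Cardinality of unions, and pairwise relations on lists.

∣p∪q∣≤∣p∣+∣q∣ : ∀ {n} (p q : Subset n) → ∣ p ∪ q ∣ ≤ ∣ p ∣ + ∣ q ∣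
∣p∪q∣≤∣p∣+∣q∣ [] [] = z≤n
∣p∪q∣≤∣p∣+∣q∣ (inside ∷ p) (inside ∷ q) =
  s≤s (≤-trans (∣p∪q∣≤∣p∣+∣q∣ p q) (+-monoʳ-≤ ∣ p ∣ (m≤n+m ∣ q ∣ 1)))
∣p∪q∣≤∣p∣+∣q∣ (inside ∷ p) (outside ∷ q) = s≤s (∣p∪q∣≤∣p∣+∣q∣ p q)
∣p∪q∣≤∣p∣+∣q∣ (outside ∷ p) (inside ∷ q) =
  ≤-trans (s≤s (∣p∪q∣≤∣p∣+∣q∣ p q)) (≤-reflexive (sym (+-suc ∣ p ∣ ∣ q ∣)))
∣p∪q∣≤∣p∣+∣q∣ (outside ∷ p) (outside ∷ q) = ∣p∪q∣≤∣p∣+∣q∣ p q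

AllPairs-lookup : ∀ {a ℓ} {A : Set a} {R : A → A → Set ℓ} → Symmetric R →
                  ∀ {xs} → AllPairs R xs → ∀ {i j} → i ≢ j → R (lookup xs i) (lookup xs j)
AllPairs-lookup symR (rx ∷ rs) {zero} {zero} i≢j = ⊥-elim (i≢j refl)
AllPairs-lookup symR (rx ∷ rs) {zero} {suc j} i≢j = All.lookup rx (∈-lookup j)
AllPairs-lookup symR (rx ∷ rs) {suc i} {zero} i≢j = symR (All.lookup rx (∈-lookup i))
AllPairs-lookup symR (rx ∷ rs) {suc i} {suc j} i≢j = AllPairs-lookup symR rs (i≢j ∘ cong suc)

-- Walks inside a vertex set.

module Walks (G : Graph) where
  open Graph G renaming (sym to Adj-sym)

  -- The end vertex need not lie in X, so that walks can reach its boundary.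
  data Within (X : Subset n) : ℕ → Fin n → Fin n → Set where
    here : ∀ {m x} → Within X m x x
    step : ∀ {m x y z} → x ∈ X → Adj x y → Within X m y z → Within X (suc m) x z

  -- The root builds in nonemptiness, and only walks from one vertex have to be exhibited;
  -- `connected-walk` recovers the others.
  Connected : Subset n → Set
  Connected X = ∃ λ x → x ∈ X × (∀ {z} → z ∈ X → ∃ λ m → Within X m x z)

  Disjoint : Subset n → Subset n → Set
  Disjoint A B = ∀ v → v ∈ A → v ∉ B

  Touch : Subset n → Subset n → Set
  Touch A B = ∃₂ λ u v → u ∈ A × v ∈ B × Adj u v

  Joined : Subset n → Subset n → Set
  Joined A B = Disjoint A B × Touch A B

  Joined-sym : Symmetric Joined
  Joined-sym (dis , u , v , u∈A , v∈B , uv) =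
    (λ v v∈B v∈A → dis v v∈A v∈B) , v , u , v∈B , u∈A , Adj-sym uv

  Within-⊆ : ∀ {X Y m x y} → X ⊆ Y → Within X m x y → Within Y m x y
  Within-⊆ X⊆Y here = here
  Within-⊆ X⊆Y (step x∈X xy w) = step (X⊆Y x∈X) xy (Within-⊆ X⊆Y w)

  Within-≤ : ∀ {X m m′ x y} → m ≤ m′ → Within X m x y → Within X m′ x y
  Within-≤ m≤m′ here = here
  Within-≤ (s≤s m≤m′) (step x∈X xy w) = step x∈X xy (Within-≤ m≤m′ w)

  Within-trans : ∀ {X m m′ x y z} → Within X m x y → Within X m′ y z → Within X (m + m′) x z
  Within-trans {m = m} {m′} here w = Within-≤ (m≤n+m m′ m) w
  Within-trans (step x∈X xy v) w = step x∈X xy (Within-trans v w)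

  Within-start : ∀ {X m x y} → Within X m x y → y ∈ X → x ∈ X
  Within-start here y∈X = y∈X
  Within-start (step x∈X _ _) _ = x∈X

  Within-snoc : ∀ {X m x y z} → Within X m x y → y ∈ X → Adj y z → Within X (suc m) x z
  Within-snoc here y∈X yz = step y∈X yz here
  Within-snoc (step x∈X xy w) y∈X yz = step x∈X xy (Within-snoc w y∈X yz)

  Within-sym : ∀ {X m x y} → Within X m x y → y ∈ X → Within X m y x
  Within-sym here _ = here
  Within-sym (step x∈X xy w) y∈X = Within-snoc (Within-sym w y∈X) (Within-start w y∈X) (Adj-sym xy)

  connected-walk : ∀ {X u v} → Connected X → u ∈ X → v ∈ X → ∃ λ m → Within X m u v
  connected-walk (_ , _ , from) u∈X v∈X =
    let m , w = from u∈X ; m′ , w′ = from v∈X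
    in m + m′ , Within-trans (Within-sym w u∈X) w′

  -- Clique minors from pairwise joined connected sets.

  cliqueMinor : ∀ {t} Bs → AllPairs Joined Bs → All Connected Bs → t ≤ length Bs → CliqueMinor G t
  cliqueMinor {t} Bs joined conn t≤ = record
    { branch = branch
    ; nonempty = λ i → let v , v∈ , _ = connectedᵢ i in v , branch-complete v∈
    ; connected = λ i u v u∈ v∈ →
        let _ , w = connected-walk (connectedᵢ i) (branch-sound u u∈) (branch-sound v v∈)
        in walkIn w v∈
    ; adjacent = λ i j i≢j →
        let _ , u , v , u∈ , v∈ , uv = joinedᵢ i≢j
        in u , v , branch-complete u∈ , branch-complete v∈ , uv
    }
    where
    B : Fin t → Subset n
    B i = lookup Bs (inject≤ i t≤)

    connectedᵢ : ∀ i → Connected (B i)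
    connectedᵢ i = All.lookup conn (∈-lookup (inject≤ i t≤))

    joinedᵢ : ∀ {i j} → i ≢ j → Joined (B i) (B j)
    joinedᵢ i≢j = AllPairs-lookup Joined-sym joined (i≢j ∘ inject≤-injective t≤ t≤ _ _)

    -- Disjointness makes the index found by `any?` the only possible one; `branch-complete` relies
    -- on this.
    branch : Fin n → Maybe (Fin t)
    branch v with any? (λ i → v ∈? B i)
    ... | yes (i , _) = just i
    ... | no _ = nothing

    branch-sound : ∀ v {i} → branch v ≡ just i → v ∈ B i
    branch-sound v eq with any? (λ i → v ∈? B i)
    branch-sound v refl | yes (i , v∈) = v∈
    branch-sound v () | no _

    branch-complete : ∀ {v i} → v ∈ B i → branch v ≡ just i
    branch-complete {v} {i} v∈ with any? (λ i → v ∈? B i)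
    ... | no ∄ = ⊥-elim (∄ (i , v∈))
    ... | yes (j , v∈′) with j ≟ i
    ... | yes j≡i = cong just j≡i
    ... | no j≢i = ⊥-elim (proj₁ (joinedᵢ j≢i) v v∈′ v∈)

    walkIn : ∀ {i m u v} → Within (B i) m u v → branch v ≡ just i →
             WalkIn G (λ w → branch w ≡ just i) u v
    walkIn here v∈ = here v∈
    walkIn (step u∈ uw w) v∈ = step (branch-complete u∈) uw (walkIn w v∈)

  -- Vertices of a walk and its initial segments.

  vertices : ∀ {X m x y} → Within X m x y → Subset n
  vertices (here {x = x}) = ⁅ x ⁆
  vertices (step {x = x} _ _ w) = ⁅ x ⁆ ∪ vertices w

  start∈vertices : ∀ {X m x y} (w : Within X m x y) → x ∈ vertices w
  start∈vertices here = x∈⁅x⁆ _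
  start∈vertices (step _ _ w) = p⊆p∪q (vertices w) (x∈⁅x⁆ _)

  end∈vertices : ∀ {X m x y} (w : Within X m x y) → y ∈ vertices w
  end∈vertices here = x∈⁅x⁆ _
  end∈vertices (step _ _ w) = q⊆p∪q _ _ (end∈vertices w)

  vertices⊆ : ∀ {X m x y} (w : Within X m x y) → y ∈ X → vertices w ⊆ X
  vertices⊆ {y = y} here y∈X p∈ = subst (_∈ _) (sym (x∈⁅y⁆⇒x≡y y p∈)) y∈X
  vertices⊆ (step {x = x} x∈X _ w) y∈X p∈ with x∈p∪q⁻ ⁅ x ⁆ (vertices w) p∈
  ... | inj₁ p∈x = subst (_∈ _) (sym (x∈⁅y⁆⇒x≡y x p∈x)) x∈X
  ... | inj₂ p∈w = vertices⊆ w y∈X p∈w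

  -- Serves to show that a union of walks with a common start is connected, which is how `newBag`
  -- gets a connected bag.
  vertices-rooted : ∀ {X m x y} (w : Within X m x y) {z} → z ∈ vertices w →
                    ∃ λ k → Within (vertices w) k x z
  vertices-rooted (here {x = x}) z∈ = 0 , subst (Within _ 0 x) (sym (x∈⁅y⁆⇒x≡y x z∈)) here
  vertices-rooted (step {x = x} x∈X xy w) z∈ with x∈p∪q⁻ ⁅ x ⁆ (vertices w) z∈
  ... | inj₁ z∈x = 0 , subst (Within _ 0 x) (sym (x∈⁅y⁆⇒x≡y x z∈x)) here
  ... | inj₂ z∈w =
    let k , v = vertices-rooted w z∈w
    in suc k , step (start∈vertices (step x∈X xy w)) xy (Within-⊆ (q⊆p∪q _ _) v)

  prefix : ℕ → ∀ {X m x y} → Within X m x y → Subset n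
  prefix zero _ = ∅
  prefix (suc k) (here {x = x}) = ⁅ x ⁆
  prefix (suc k) (step {x = x} _ _ w) = ⁅ x ⁆ ∪ prefix k w

  ∣prefix∣≤ : ∀ k {X m x y} (w : Within X m x y) → ∣ prefix k w ∣ ≤ k
  ∣prefix∣≤ zero _ = ≤-reflexive (∣⊥∣≡0 n)
  ∣prefix∣≤ (suc k) (here {x = x}) = ≤-trans (≤-reflexive (∣⁅x⁆∣≡1 x)) (s≤s z≤n)
  ∣prefix∣≤ (suc k) (step {x = x} _ _ w) =
    ≤-trans (∣p∪q∣≤∣p∣+∣q∣ ⁅ x ⁆ (prefix k w))
            (+-mono-≤ (≤-reflexive (∣⁅x⁆∣≡1 x)) (∣prefix∣≤ k w))

  prefix-mono : ∀ {k k′ X m x y} (w : Within X m x y) → k ≤ k′ → prefix k w ⊆ prefix k′ w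
  prefix-mono w z≤n p∈ = ⊥-elim (∉⊥ p∈)
  prefix-mono here (s≤s _) p∈ = p∈
  prefix-mono {suc k} (step {x = x} _ _ w) (s≤s k≤k′) p∈ with x∈p∪q⁻ ⁅ x ⁆ (prefix k w) p∈
  ... | inj₁ p∈x = x∈p∪q⁺ (inj₁ p∈x)
  ... | inj₂ p∈w = x∈p∪q⁺ (inj₂ (prefix-mono w k≤k′ p∈w))

  -- Splits the length bound at `p`. On a shortest walk, reaching `p` in `l` steps and then
  -- finishing in `j` steps costs at least `i + j`, so `i ≤ l`; `shortest-thin` takes `l = ρ + ρ`.
  vertex-position : ∀ {X m x y p} (w : Within X m x y) → p ∈ vertices w →
                    ∃₂ λ i j → i + j ≡ m × Within X j p y × p ∈ prefix (suc i) w
  vertex-position {m = m} {y = y} here p∈ =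
    0 , m , refl , subst (λ q → Within _ m q y) (sym (x∈⁅y⁆⇒x≡y y p∈)) here , p∈
  vertex-position {m = m} {y = y} v@(step {x = x} x∈X xy w) p∈ with x∈p∪q⁻ ⁅ x ⁆ (vertices w) p∈
  ... | inj₁ p∈x =
    0 , m , refl , subst (λ q → Within _ m q y) (sym (x∈⁅y⁆⇒x≡y x p∈x)) v , x∈p∪q⁺ (inj₁ p∈x)
  ... | inj₂ p∈w =
    let i , j , i+j≡m , u , p∈i = vertex-position w p∈w
    in suc i , j , cong suc i+j≡m , u , x∈p∪q⁺ (inj₂ p∈i)

  -- Sets with few vertices near each point of the territory.

  Thin : ℕ → ℕ → Subset n → Subset n → Set
  Thin ρ b X N = ∀ {x} → x ∈ X → ∃ λ L → ∣ L ∣ ≤ b × (∀ {p} → p ∈ N → Within X ρ x p → p ∈ L)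

  -- Distances are measured inside the territory, so they can only grow when it shrinks: a bag stays
  -- thin for as long as it is kept.
  Thin-⊆ : ∀ {ρ b X Y N} → Y ⊆ X → Thin ρ b X N → Thin ρ b Y N
  Thin-⊆ Y⊆X thin y∈Y =
    let L , ∣L∣≤b , covers = thin (Y⊆X y∈Y)
    in L , ∣L∣≤b , λ p∈N w → covers p∈N (Within-⊆ Y⊆X w)

  Thin-≤ : ∀ {ρ b b′ X N} → b ≤ b′ → Thin ρ b X N → Thin ρ b′ X N
  Thin-≤ b≤b′ thin x∈X =
    let L , ∣L∣≤b , covers = thin x∈X in L , ≤-trans ∣L∣≤b b≤b′ , covers

  Thin-∪ : ∀ {ρ b b′ X N N′} → Thin ρ b X N → Thin ρ b′ X N′ → Thin ρ (b + b′) X (N ∪ N′)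
  Thin-∪ {N = N} {N′} thin thin′ x∈X =
    let L , ∣L∣≤b , covers = thin x∈X
        L′ , ∣L′∣≤b′ , covers′ = thin′ x∈X
    in L ∪ L′ , ≤-trans (∣p∪q∣≤∣p∣+∣q∣ L L′) (+-mono-≤ ∣L∣≤b ∣L′∣≤b′) ,
       λ p∈ w → [ (λ p∈N → x∈p∪q⁺ (inj₁ (covers p∈N w)))
                , (λ p∈N′ → x∈p∪q⁺ (inj₂ (covers′ p∈N′ w))) ]′ (x∈p∪q⁻ N N′ p∈)

  Thin-⁅⁆ : ∀ {ρ X x} → Thin ρ 1 X ⁅ x ⁆
  Thin-⁅⁆ {x = x} _ = ⁅ x ⁆ , ≤-reflexive (∣⁅x⁆∣≡1 x) , λ p∈ _ → p∈

-- Shortest walks under decidable adjacency.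

module Decidable (G : Graph) (adj? : ∀ u v → Dec (Graph.Adj G u v)) where
  open Graph G hiding (sym)
  open Walks G

  within? : ∀ X m x y → Dec (Within X m x y)
  within? X zero x y = map′ (λ { refl → here }) (λ { here → refl }) (x ≟ y)
  within? X (suc m) x y = map′ to from
    (x ≟ y ⊎-dec x ∈? X ×-dec any? (λ z → adj? x z ×-dec within? X m z y))
    where
    to : x ≡ y ⊎ x ∈ X × (∃ λ z → Adj x z × Within X m z y) → Within X (suc m) x y
    to (inj₁ refl) = here
    to (inj₂ (x∈X , _ , xz , w)) = step x∈X xz w
    from : Within X (suc m) x y → x ≡ y ⊎ x ∈ X × (∃ λ z → Adj x z × Within X m z y)
    from here = inj₁ refl
    from (step x∈X xz w) = inj₂ (x∈X , _ , xz , w)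

  touch? : ∀ A B → Dec (Touch A B)
  touch? A B = map′ (λ { (u , u∈A , v , v∈B , uv) → u , v , u∈A , v∈B , uv })
                    (λ { (u , v , u∈A , v∈B , uv) → u , u∈A , v , v∈B , uv })
    (any? λ u → u ∈? A ×-dec any? λ v → v ∈? B ×-dec adj? u v)

  Shortest : ∀ {X m x y} → Within X m x y → Set
  Shortest {X} {m} {x} {y} _ = ∀ {k} → Within X k x y → m ≤ k

  -- The bound is lowered one step at a time. `Within` is monotone in it, so the first failure
  -- excludes all smaller bounds too.
  shortest : ∀ {X} m {x y} → Within X m x y → ∃ λ k → ∃ λ (w : Within X k x y) → Shortest w
  shortest zero w = zero , w , λ _ → z≤n
  shortest {X} (suc m) {x} {y} w with within? X m x y
  ... | yes w′ = shortest m w′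
  ... | no ∄ = suc m , w , λ {k} v → ≰⇒> (λ k≤m → ∄ (Within-≤ k≤m v))

  -- Two vertices of a shortest walk that are both within ρ of x are at most
  -- 2ρ apart on it, so those within ρ of x lie in a window of 2ρ + 1 vertices.
  shortest-thin : ∀ {X ρ m a b} (w : Within X m a b) → Shortest w → b ∈ X →
                  Thin ρ (suc (ρ + ρ)) X (vertices w)
  shortest-thin {X} {ρ} {m} {a} {b} w sh b∈X {x} x∈X with within? X ρ x a
  ... | yes xa = prefix (suc (ρ + ρ)) w , ∣prefix∣≤ _ w , λ p∈ xp →
    let i , j , i+j≡m , pb , p∈i = vertex-position w p∈
        ap = Within-trans (Within-sym xa (Within-start w b∈X)) xp
        i≤2ρ = +-cancelʳ-≤ j i (ρ + ρ)
                 (subst (_≤ ρ + ρ + j) (sym i+j≡m) (sh (Within-trans ap pb)))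
    in prefix-mono w (s≤s i≤2ρ) p∈i
  -- A start farther than `ρ` from `x` needs no place in `L`; it is dropped, and the tail is again a
  -- shortest walk.
  shortest-thin {b = b} here sh b∈X {x} x∈X | no ∄ =
    ∅ , ≤-trans (≤-reflexive (∣⊥∣≡0 n)) z≤n ,
    λ p∈ xp → ⊥-elim (∄ (subst (Within _ _ x) (x∈⁅y⁆⇒x≡y b p∈) xp))
  shortest-thin {a = a} (step a∈X az w) sh b∈X {x} x∈X | no ∄ =
    let L , ∣L∣≤ , covers = shortest-thin w (λ v → ≤-pred (sh (step a∈X az v))) b∈X x∈X
    in L , ∣L∣≤ , λ p∈ xp →
       [ (λ p∈a → ⊥-elim (∄ (subst (Within _ _ x) (x∈⁅y⁆⇒x≡y a p∈a) xp)))
       , (λ p∈w → covers p∈w xp) ]′ (x∈p∪q⁻ ⁅ a ⁆ (vertices w) p∈)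

  -- Components of induced subgraphs, and bags.

  Closed : Subset n → Subset n → Set
  Closed X S = ∀ {u v} → u ∈ S → Adj u v → v ∈ X → v ∈ S

  -- Neighbours in `X` are added to `⁅ x ⁆` one at a time until none is left. Each new vertex
  -- prolongs a walk inside the set, and strict growth ends the recursion.
  component : ∀ X {x} → x ∈ X → ∃ λ S → x ∈ S × S ⊆ X × Closed X S × Connected S
  component X {x} x∈X = grow ⁅ x ⁆ (⊃-wellFounded _) (x∈⁅x⁆ x)
    (λ z∈ → subst (_∈ X) (sym (x∈⁅y⁆⇒x≡y x z∈)) x∈X)
    (λ z∈ → 0 , subst (Within _ 0 x) (sym (x∈⁅y⁆⇒x≡y x z∈)) here)
    where
    grow : ∀ S → Acc _⊃_ S → x ∈ S → S ⊆ X → (∀ {z} → z ∈ S → ∃ λ m → Within S m x z) →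
           ∃ λ S → x ∈ S × S ⊆ X × Closed X S × Connected S
    grow S (acc rec) x∈S S⊆X walks
      with any? (λ u → u ∈? S ×-dec any? λ v → adj? u v ×-dec v ∈? X ×-dec ¬? (v ∈? S))
    ... | no ∄ = S , x∈S , S⊆X , closed , x , x∈S , walks
      where
      closed : Closed X S
      closed {u} {v} u∈S uv v∈X with v ∈? S
      ... | yes v∈S = v∈S
      ... | no v∉S = ⊥-elim (∄ (u , u∈S , v , uv , v∈X , v∉S))
    ... | yes (u , u∈S , v , uv , v∈X , v∉S) =
      grow (S ∪ ⁅ v ⁆) (rec (p⊆p∪q _ , v , q⊆p∪q S _ (x∈⁅x⁆ v) , v∉S)) (p⊆p∪q _ x∈S)
        (λ z∈ → [ S⊆X , (λ z∈v → subst (_∈ X) (sym (x∈⁅y⁆⇒x≡y v z∈v)) v∈X) ]′ (x∈p∪q⁻ S ⁅ v ⁆ z∈))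
        (λ z∈ → [ (λ z∈S → let m , w = walks z∈S in m , Within-⊆ (p⊆p∪q _) w)
                , (λ z∈v → let m , w = walks u∈S in
                     suc m , subst (Within _ _ x) (sym (x∈⁅y⁆⇒x≡y v z∈v))
                       (Within-⊆ (p⊆p∪q _) (Within-snoc w u∈S uv))) ]′ (x∈p∪q⁻ S ⁅ v ⁆ z∈))

  -- For each bag a shortest walk of `X` runs from `x` to a vertex of `X` adjacent to that bag,
  -- hence stays inside `X`. Each walk adds `suc (ρ + ρ)` to the cost by `shortest-thin`; the final
  -- `1` pays for `⁅ x ⁆`, the whole bag when there are no others.
  newBag : ∀ ρ {X x} → Connected X → x ∈ X → ∀ bags → All (Touch X) bags →
           ∃ λ N → N ⊆ X × x ∈ N × (∀ {z} → z ∈ N → ∃ λ m → Within N m x z) ×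
                   All (Touch N) bags × Thin ρ (length bags * suc (ρ + ρ) + 1) X N
  newBag ρ {X} {x} conn x∈X [] [] =
    ⁅ x ⁆ , (λ z∈ → subst (_∈ X) (sym (x∈⁅y⁆⇒x≡y x z∈)) x∈X) , x∈⁅x⁆ x ,
    (λ z∈ → 0 , subst (Within _ 0 x) (sym (x∈⁅y⁆⇒x≡y x z∈)) here) , [] , Thin-⁅⁆
  newBag ρ {X} {x} conn x∈X (b ∷ bags) ((u , v , u∈X , v∈b , uv) ∷ touches) =
    let N , N⊆X , x∈N , rooted , touchN , thin = newBag ρ conn x∈X bags touches
        m , w₀ = connected-walk conn x∈X u∈X
        k , w , sh = shortest m w₀
        P = vertices w
    in P ∪ N ,
       (λ z∈ → [ vertices⊆ w u∈X , N⊆X ]′ (x∈p∪q⁻ P N z∈)) ,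
       q⊆p∪q P N x∈N ,
       (λ z∈ → [ (λ z∈P → let i , w′ = vertices-rooted w z∈P in i , Within-⊆ (p⊆p∪q N) w′)
               , (λ z∈N → let i , w′ = rooted z∈N in i , Within-⊆ (q⊆p∪q P N) w′) ]′
               (x∈p∪q⁻ P N z∈)) ,
       (u , v , p⊆p∪q N (end∈vertices w) , v∈b , uv) ∷
         All.map (λ { (u , v , u∈N , v∈ , uv) → u , v , q⊆p∪q P N u∈N , v∈ , uv }) touchN ,
       Thin-≤ (≤-reflexive (sym (+-assoc (suc (ρ + ρ)) (length bags * suc (ρ + ρ)) 1)))
              (Thin-∪ (shortest-thin w sh u∈X) thin)

  -- Supplies the cops' next set: for each bag, a small set containing all its vertices within `ρ`
  -- of the robber.
  cover : ∀ {ρ b X x} bags → All (Thin ρ b X) bags → x ∈ X →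
          ∃ λ L → ∣ L ∣ ≤ length bags * b ×
                  (∀ {p} → Any (p ∈_) bags → Within X ρ x p → p ∈ L)
  cover [] [] x∈X = ∅ , ≤-reflexive (∣⊥∣≡0 n) , λ ()
  cover (_ ∷ bags) (thin ∷ thins) x∈X =
    let L , ∣L∣≤ , covers = thin x∈X
        L′ , ∣L′∣≤ , covers′ = cover bags thins x∈X
    in L ∪ L′ , ≤-trans (∣p∪q∣≤∣p∣+∣q∣ L L′) (+-mono-≤ ∣L∣≤ ∣L′∣≤) ,
       λ { (here p∈) w → x∈p∪q⁺ (inj₁ (covers p∈ w))
         ; (there p∈) w → x∈p∪q⁺ (inj₂ (covers′ p∈ w)) }

  -- Only the end of a walk may lie outside `X`, so a walk that leaves `X` does so at its last step.
  lastStep : ∀ {X m x p} → Within X m x p → x ∈ X → p ∉ X → ∃ λ z → z ∈ X × Adj z p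
  lastStep here x∈X p∉X = ⊥-elim (p∉X x∈X)
  lastStep {X} (step {x = x} {y = y} x∈X xy w) _ p∉X with y ∈? X
  ... | yes y∈X = lastStep w y∈X p∉X
  lastStep (step {x = x} x∈X xy here) _ p∉X | no y∉X = x , x∈X , xy
  lastStep (step x∈X xy (step y∈X _ _)) _ p∉X | no y∉X = ⊥-elim (y∉X y∈X)

  -- A boundary vertex first met at the very last step of the robber's move need
  -- not be occupied before the move: the robber then stops on a vertex of S′.
  confined : ∀ {r′ X S S′ x} →
             (∀ {p} → p ∉ X → Within X r′ x p → p ∈ S) →
             (∀ {p} → p ∉ X → Within X (suc r′) x p → p ∈ S′) →
             ∀ {i m z x′} → i + m ≤ suc r′ → z ∈ X → Within X i x z → Reach G (S ∩ S′) m z x′ →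
             x′ ∈ S′ ⊎ x′ ∈ X × Within X (suc r′) x x′
  confined {r′} guard guard′ {i} {m} i+m≤ z∈X w (here _) =
    inj₂ (z∈X , Within-≤ (≤-trans (m≤m+n i m) i+m≤) w)
  confined {r′} {X} guard guard′ {i} {suc m} i+m≤ z∈X w (step {y = y} _ zy rest) with y ∈? X
  ... | yes y∈X = confined guard guard′ (subst (_≤ suc r′) (+-suc i m) i+m≤) y∈X (Within-snoc w z∈X zy) rest
  confined {r′} guard guard′ {i} {suc m} i+m≤ z∈X w (step _ zy (here _)) | no y∉X =
    inj₁ (guard′ y∉X (Within-≤ (≤-trans (m≤m+n (suc i) m) (subst (_≤ suc r′) (+-suc i m) i+m≤))
                               (Within-snoc w z∈X zy)))
  -- The robber goes on after `y`, so `y` is within `r′` of `x` and lies in both cop sets; the move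
  -- may not pass through it.
  confined {r′} guard guard′ {i} {suc (suc m)} i+m≤ z∈X w (step _ zy (step y∉S∩S′ _ _)) | no y∉X =
    ⊥-elim (y∉S∩S′ (x∈p∩q⁺ (guard y∉X wy , guard′ y∉X (Within-≤ (m≤n+m _ 1) wy))))
    where
    wy = Within-≤ (≤-trans (m≤m+n (suc i) m)
                     (≤-pred (subst (_≤ suc r′) (trans (+-suc i (suc m)) (cong suc (+-suc i m))) i+m≤)))
                  (Within-snoc w z∈X zy)

  -- The cops' strategy.

  module Strategy (r′ s k : ℕ) (noMinor : ¬ CliqueMinor G (suc (suc s))) where

    -- In the paper's notation r = suc r′ and t = suc (suc s), so ρ is 2r - 1.
    ρ bagCost : ℕ
    ρ = suc r′ + r′
    bagCost = s * suc (ρ + ρ) + 1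

    -- The robber, at x, is confined to the territory X.
    record Position (S : Subset n) (x : Fin n) (X : Subset n) : Set where
      field
        inside-X : x ∈ X
        bags     : List (Subset n)
        joined   : AllPairs Joined (X ∷ bags)
        conn     : All Connected (X ∷ bags)
        thin     : All (Thin ρ bagCost X) bags
        boundary : ∀ {z p} → z ∈ X → Adj z p → p ∉ X → Any (p ∈_) bags
        guard    : ∀ {p} → p ∉ X → Within X r′ x p → p ∈ S

    -- No edge leaves the component of `x` in the whole graph, so `boundary` and `guard` are vacuous
    -- even without bags or cops.
    initial : ∀ x → ∃ λ X → Position ∅ x X
    initial x =
      let X , x∈X , _ , closed , conn = component ⊤ (∈⊤ {x = x})
      in X , record
        { inside-X = x∈X
        ; bags = []
        ; joined = [] ∷ []
        ; conn = conn ∷ []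
        ; thin = []
        ; boundary = λ z∈X zp p∉X → ⊥-elim (p∉X (closed z∈X zp ∈⊤))
        ; guard = λ p∉X w → let _ , z∈X , zp = lastStep w x∈X p∉X in
                            ⊥-elim (p∉X (closed z∈X zp ∈⊤))
        }

    reply : ∀ {S x X} → suc s * bagCost ≤ k → Position S x X → ∃ λ S′ → ∣ S′ ∣ ≤ k ×
            (∀ x′ → Reach G (S ∩ S′) (suc r′) x x′ → x′ ∈ S′ ⊎ ∃ λ X′ → X′ ⊂ X × Position S′ x′ X′)
    reply {S} {x} {X} fits pos with joined | conn
      where open Position pos
    ... | joinedX ∷ joinedBags | connX ∷ connBags = S′ , ∣S′∣≤k , respond
      where
      open Position pos

      -- With `suc s` bags or more, `X` and the bags would provide `suc (suc s)` branch sets.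
      few : length bags ≤ s
      few = ≤-pred (≰⇒> λ s<length → noMinor (cliqueMinor (X ∷ bags) joined conn (s≤s s<length)))

      bag : _
      bag = newBag ρ connX inside-X bags (All.map proj₂ joinedX)

      N = proj₁ bag

      N⊆X : N ⊆ X
      N⊆X = proj₁ (proj₂ bag)

      x∈N : x ∈ N
      x∈N = proj₁ (proj₂ (proj₂ bag))

      connN : Connected N
      connN = x , x∈N , proj₁ (proj₂ (proj₂ (proj₂ bag)))

      touchN : All (Touch N) bags
      touchN = proj₁ (proj₂ (proj₂ (proj₂ (proj₂ bag))))

      thinN : Thin ρ bagCost X N
      thinN = Thin-≤ (+-monoˡ-≤ 1 (*-monoˡ-≤ (suc (ρ + ρ)) few))
                     (proj₂ (proj₂ (proj₂ (proj₂ (proj₂ bag)))))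

      joinedN : All (Joined N) bags
      joinedN = All.zipWith (λ { ((dis , _) , touch) → (λ v v∈N → dis v (N⊆X v∈N)) , touch })
                            (joinedX , touchN)

      cops : _
      cops = cover (N ∷ bags) (thinN ∷ thin) inside-X

      S′ = proj₁ cops

      -- At most `s` old bags and the new one, each at cost `bagCost`.
      ∣S′∣≤k : ∣ S′ ∣ ≤ k
      ∣S′∣≤k = ≤-trans (proj₁ (proj₂ cops)) (≤-trans (*-monoˡ-≤ bagCost (s≤s few)) fits)

      occupied : ∀ {p} → Any (p ∈_) (N ∷ bags) → Within X ρ x p → p ∈ S′
      occupied = proj₂ (proj₂ cops)

      guard′ : ∀ {p} → p ∉ X → Within X (suc r′) x p → p ∈ S′
      guard′ p∉X w =
        let _ , z∈X , zp = lastStep w inside-X p∉X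
        in occupied (there (boundary z∈X zp p∉X)) (Within-≤ (m≤m+n (suc r′) r′) w)

      -- The old vertex `x` lies in `X` and in `N`, so the new territory misses it. This strict
      -- decrease is what ends the game.
      advance : ∀ {x′} → x′ ∈ X → Within X (suc r′) x x′ → x′ ∉ N → ∃ λ X′ → X′ ⊂ X × Position S′ x′ X′
      advance {x′} x′∈X xx′ x′∉N = X′ , (X′⊆X , x , inside-X , λ x∈X′ → X′∩N x x∈X′ x∈N) , record
        { inside-X = x′∈X′
        ; bags = filter (touch? X′) (N ∷ bags)
        ; joined = All.zipWith (λ z → z)
              (All-filter⁺ (touch? X′) disjoint , all-filter (touch? X′) (N ∷ bags))
            ∷ AllPairs-filter⁺ (touch? X′) (joinedN ∷ joinedBags)
        ; conn = connX′ ∷ All-filter⁺ (touch? X′) (connN ∷ connBags)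
        ; thin = All.map (Thin-⊆ X′⊆X) (All-filter⁺ (touch? X′) (thinN ∷ thin))
        -- A bag containing a neighbour of `X′` touches `X′`, so the filter has kept it.
        ; boundary = λ {z} {p} z∈X′ zp p∉X′ →
            let _ , b∈ , p∈b = find (leaves z∈X′ zp p∉X′)
            in lose (∈-filter⁺ (touch? X′) b∈ (z , p , z∈X′ , p∈b , zp)) p∈b
        -- Here the value of `ρ` is determined: a move of length `suc r′` to `x′`, then a walk of
        -- length `r′` to `p`, while `S′` was chosen around the old vertex `x`.
        ; guard = λ p∉X′ w →
            let _ , z∈X′ , zp = lastStep w x′∈X′ p∉X′
            in occupied (leaves z∈X′ zp p∉X′) (Within-trans xx′ (Within-⊆ X′⊆X w))
        }
        where
        comp : _
        comp = component (X ∩ ∁ N) (x∈p∩q⁺ (x′∈X , x∉p⇒x∈∁p x′∉N))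

        X′ = proj₁ comp

        x′∈X′ : x′ ∈ X′
        x′∈X′ = proj₁ (proj₂ comp)

        X′⊆X∖N : X′ ⊆ X ∩ ∁ N
        X′⊆X∖N = proj₁ (proj₂ (proj₂ comp))

        closed : Closed (X ∩ ∁ N) X′
        closed = proj₁ (proj₂ (proj₂ (proj₂ comp)))

        connX′ : Connected X′
        connX′ = proj₂ (proj₂ (proj₂ (proj₂ comp)))

        X′⊆X : X′ ⊆ X
        X′⊆X z∈X′ = proj₁ (x∈p∩q⁻ X (∁ N) (X′⊆X∖N z∈X′))

        X′∩N : Disjoint X′ N
        X′∩N z z∈X′ = x∈∁p⇒x∉p (proj₂ (x∈p∩q⁻ X (∁ N) (X′⊆X∖N z∈X′)))

        disjoint : All (Disjoint X′) (N ∷ bags)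
        disjoint = X′∩N ∷ All.map (λ { (dis , _) z z∈X′ → dis z (X′⊆X z∈X′) }) joinedX

        leaves : ∀ {z p} → z ∈ X′ → Adj z p → p ∉ X′ → Any (p ∈_) (N ∷ bags)
        leaves {p = p} z∈X′ zp p∉X′ with p ∈? N | p ∈? X
        ... | yes p∈N | _ = here p∈N
        ... | no p∉N | yes p∈X = ⊥-elim (p∉X′ (closed z∈X′ zp (x∈p∩q⁺ (p∈X , x∉p⇒x∈∁p p∉N))))
        ... | no _ | no p∉X = there (boundary (X′⊆X z∈X′) zp p∉X)

      respond : ∀ x′ → Reach G (S ∩ S′) (suc r′) x x′ → x′ ∈ S′ ⊎ ∃ λ X′ → X′ ⊂ X × Position S′ x′ X′
      respond x′ walk with confined guard guard′ {i = 0} ≤-refl inside-X here walk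
      ... | inj₁ caught = inj₁ caught
      ... | inj₂ (x′∈X , xx′) with x′ ∈? N
      -- Ending in `N` means capture, because the move is no longer than `ρ`.
      ... | yes x′∈N = inj₁ (occupied (here x′∈N) (Within-≤ (m≤m+n (suc r′) r′) xx′))
      ... | no x′∉N = inj₂ (advance x′∈X xx′ x′∉N)

    play : suc s * bagCost ≤ k → ∀ {S x} X → Acc _⊂_ X → Position S x X →
           CopsWinFrom G (suc r′) k S x
    play fits X (acc rec) pos =
      let S′ , ∣S′∣≤k , respond = reply fits pos
      in win S′ ∣S′∣≤k λ x′ walk → [ inj₁ , (λ { (X′ , X′⊂X , pos′) →
           inj₂ (play fits X′ (rec X′⊂X) pos′) }) ]′ (respond x′ walk)

    copsWin : suc s * bagCost ≤ k → CopsWin G (suc r′) k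
    copsWin fits = ∅ , ≤-trans (≤-reflexive (∣⊥∣≡0 n)) z≤n , λ x →
      let X , pos = initial x in inj₂ (play fits X (⊂-wellFounded X) pos)

-- Games on the subgraph of known edges.

module Unveiling (G : Graph) where
  open Graph G renaming (sym to Adj-sym)

  -- Pairs are coded by `combine` so that the known edges form a `Subset`: membership is then
  -- decidable, and `⊃-wellFounded` limits the restarts.
  Sound : Subset (n * n) → Set
  Sound E = ∀ u v → combine u v ∈ E → Adj u v

  known : (E : Subset (n * n)) → Sound E → Graph
  known E sound = record
    { n = n
    ; Adj = λ u v → combine u v ∈ E ⊎ combine v u ∈ E
    ; sym = [ inj₂ , inj₁ ]′
    ; irref = λ e → irref ([ sound _ _ , sound _ _ ]′ e)
    }

  module _ {E : Subset (n * n)} {sound : Sound E} where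

    private H = known E sound

    known⇒Adj : ∀ {u v} → Graph.Adj H u v → Adj u v
    known⇒Adj = [ sound _ _ , (λ vu → Adj-sym (sound _ _ vu)) ]′

    walkIn : ∀ {P u v} → WalkIn H P u v → WalkIn G P u v
    walkIn (here p) = here p
    walkIn (step p uv w) = step p (known⇒Adj uv) (walkIn w)

    cliqueMinor : ∀ {t} → CliqueMinor H t → CliqueMinor G t
    cliqueMinor M = record
      { branch = branch
      ; nonempty = nonempty
      ; connected = λ i u v u∈ v∈ → walkIn (connected i u v u∈ v∈)
      ; adjacent = λ i j i≢j → let u , v , u∈ , v∈ , uv = adjacent i j i≢j in
                               u , v , u∈ , v∈ , known⇒Adj uv
      }
      where open CliqueMinor M

    known? : ∀ u v → Dec (Graph.Adj H u v)
    known? u v = combine u v ∈? E ⊎-dec combine v u ∈? E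

    NewEdge : Set
    NewEdge = ∃₂ λ u v → Adj u v × combine u v ∉ E

    -- The robber's walk carries a proof of adjacency for each of its steps, so only membership in
    -- `E` has to be decided.
    reach : ∀ {S m x y} → Reach G S m x y → Reach H S m x y ⊎ NewEdge
    reach (here x∉S) = inj₁ (here x∉S)
    reach (step {x = x} {y = y} x∉S xy w) with known? x y | reach w
    ... | no new | _ = inj₂ (x , y , xy , new ∘ inj₁)
    ... | yes _ | inj₂ new = inj₂ new
    ... | yes xy∈ | inj₁ w′ = inj₁ (step x∉S xy∈ w′)

    -- The winning strategy on the known graph is copied until a move reveals a new edge; `restart`
    -- then takes over from the position reached.
    follow : ∀ {r k} → (NewEdge → ∀ S x → CopsWinFrom G r k S x) →
             ∀ {S x} → CopsWinFrom H r k S x → CopsWinFrom G r k S x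
    follow restart (win S′ ∣S′∣≤k respond) = win S′ ∣S′∣≤k λ x′ walk → next x′ (reach walk)
      where
      next : ∀ x′ → Reach H _ _ _ x′ ⊎ NewEdge → x′ ∈ S′ ⊎ CopsWinFrom G _ _ S′ x′
      next x′ (inj₂ new) = inj₂ (restart new S′ x′)
      next x′ (inj₁ walk) with respond x′ walk
      ... | inj₁ caught = inj₁ caught
      ... | inj₂ wins = inj₂ (follow restart wins)

  addEdge : ∀ {E u v} → Sound E → Adj u v → Sound (E ∪ ⁅ combine u v ⁆)
  addEdge {E} {u} {v} sound uv u′ v′ e with x∈p∪q⁻ E ⁅ combine u v ⁆ e
  ... | inj₁ e∈E = sound u′ v′ e∈E
  ... | inj₂ e≡ with combine-injective u′ v′ u v (x∈⁅y⁆⇒x≡y _ e≡)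
  ... | refl , refl = uv

  -- All positions are allowed because restarts happen in mid-game. The cops go to the opening set
  -- `C₀`, and `wins₀` handles every vertex the robber may then occupy. Each restart enlarges `E`.
  winsAnywhere : ∀ {r k} → (∀ E sound → CopsWin (known E sound) r k) →
                 ∀ E → Acc _⊃_ E → Sound E →
                 ∀ S x → CopsWinFrom G r k S x
  winsAnywhere {r} {k} wins E (acc rec) sound S x = win C₀ ∣C₀∣≤k λ x′ _ →
    [ inj₁ , inj₂ ∘ follow {sound = sound} restart ]′ (wins₀ x′)
    where
    C₀ = proj₁ (wins E sound)
    ∣C₀∣≤k = proj₁ (proj₂ (wins E sound))
    wins₀ = proj₂ (proj₂ (wins E sound))

    restart : NewEdge {sound = sound} → ∀ S x → CopsWinFrom G r k S x
    restart (u , v , uv , uv∉E) =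
      winsAnywhere wins (E ∪ ⁅ combine u v ⁆)
        (rec (p⊆p∪q _ , combine u v , q⊆p∪q E _ (x∈⁅x⁆ _) , uv∉E)) (addEdge sound uv)

  copsWin : ∀ {r k} → (∀ E sound → CopsWin (known E sound) r k) → CopsWin G r k
  copsWin wins = ∅ , ≤-trans (≤-reflexive (∣⊥∣≡0 n)) z≤n , λ x →
    inj₂ (winsAnywhere wins ∅ (⊃-wellFounded ∅) (λ _ _ → ⊥-elim ∘ ∉⊥) ∅ x)

-- The number of cops.

2*[1+n]C2 : ∀ n → 2 * (suc n C 2) ≡ suc n * n
2*[1+n]C2 zero = refl
2*[1+n]C2 (suc n) = trans (cong (2 *_) (sym (nCk+nC[k+1]≡[n+1]C[k+1] (suc n) 1)))
  (trans (*-distribˡ-+ 2 (suc n C 1) (suc n C 2))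
    (trans (cong₂ (λ a b → 2 * a + b) (nC1≡n (suc n)) (2*[1+n]C2 n)) (lemma n)))
  where
  lemma : ∀ n → 2 * suc n + suc n * n ≡ suc (suc n) * suc n
  lemma = solve-∀

-- Doubling both sides turns the binomial coefficient into `suc (suc s) * suc s` and leaves a
-- polynomial inequality.
budget : ∀ s r → let ρ = suc r + r in
         suc (suc s) * (suc s * suc (ρ + ρ) + 1) ≤ (suc (suc s) C 2) * (8 * suc r + 1)
budget s r = *-cancelˡ-≤ 2 (begin
  2 * (suc (suc s) * (suc s * suc (suc r + r + (suc r + r)) + 1))
    -- With `R = suc r`, `suc (ρ + ρ)` is `4R - 1`, and `suc s * (8R + 1)` exceeds
    -- `2 * (suc s * (4R - 1) + 1)` by exactly `3 * s + 1`.
    ≤⟨ m≤m+n _ (suc (suc s) * (3 * s + 1)) ⟩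
  2 * (suc (suc s) * (suc s * suc (suc r + r + (suc r + r)) + 1)) + suc (suc s) * (3 * s + 1)
    ≡⟨ identity s r ⟩
  suc (suc s) * suc s * (8 * suc r + 1)
    ≡⟨ cong (_* (8 * suc r + 1)) (2*[1+n]C2 (suc s)) ⟨
  2 * (suc (suc s) C 2) * (8 * suc r + 1)
    ≡⟨ *-assoc 2 (suc (suc s) C 2) (8 * suc r + 1) ⟩
  2 * ((suc (suc s) C 2) * (8 * suc r + 1)) ∎)
  where
  open ≤-Reasoning
  identity : ∀ s r → 2 * (suc (suc s) * (suc s * suc (suc r + r + (suc r + r)) + 1)) +
                     suc (suc s) * (3 * s + 1) ≡ suc (suc s) * suc s * (8 * suc r + 1)
  identity = solve-∀

theorem5 : (r t : ℕ) → 1 ≤ r → 3 ≤ t → (G : Graph) → ¬ HasCliqueMinor G t →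
    CopWidthAtMost G r (((t ∸ 1) C 2) * (8 * r + 1))
theorem5 (suc r) (suc (suc (suc s))) (s≤s _) (s≤s (s≤s (s≤s _))) G noMinor =
  -- The bound itself is the number of cops; it is at least 1 because the left side of `budget` is
  -- positive.
  (suc (suc s) C 2) * (8 * suc r + 1) , ≤-trans (s≤s z≤n) (budget s r) , ≤-refl ,
  Unveiling.copsWin G λ E sound →
    -- `Strategy` excludes a minor of order two more than its parameter, which is therefore `suc s`
    -- here.
    Decidable.Strategy.copsWin (Unveiling.known G E sound) (Unveiling.known? G {sound = sound}) r (suc s) _
      (noMinor ∘ Unveiling.cliqueMinor G {sound = sound}) (budget s r)
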